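{- For every integer $n\ge 6$, $K(\lfloor 1.53\, n\rfloor,4)\ge 40\cdot 3^{(n-8)/3}$, and hence $K(n,4)\ge 40\cdot 3^{(\lfloor 0.6535\, n \rfloor-8)/3}$.
   Context: $I(n)$ denotes the graph of the $n$-dimensional hypercube: vertices are binary vectors of length $n$, two vertices adjacent iff they differ in exactly one coordinate. For an induced subgraph $G$ of $I(n)$ and vertices $x,x'$ of $G$, $d_G(x,x')$ is the length of a shortest path from $x$ to $x'$ in $G$; $d_{I(n)}(x,x')$ is the Hamming distance. An induced subgraph $C$ of $I(n)$ is an $(n,k)$ circuit code (circuit code of spread $k$) if $C$ is a cycle and for all vertices $x,x'$ of $C$ with $d_{I(n)}(x,x')<k$ we have $d_C(x,x')=d_{I(n)}(x,x')$. The length of a circuit code is its number of vertices. $K(n,k)$ denotes the maximum length of an $(n,k)$ circuit code. -}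

module Defs where

open import Data.Nat using (ℕ; zero; suc; _+_; _*_; _∸_; _^_; _≤_; _<_; _⊓_; ∣_-_∣)
open import Data.Nat.DivMod using (_/_)
open import Data.Bool using (Bool; true; false; if_then_else_)
open import Data.Vec using (Vec; []; _∷_)
open import Data.Fin using (Fin; toℕ)
open import Data.Product using (∃; _×_)
open import Function.Definitions using (Injective)
open import Relation.Binary.PropositionalEquality using (_≡_)
open import Relation.Nullary using (¬_)
open import Relation.Nullary.Decidable using (⌊_⌋)
open import Data.Bool.Properties using () renaming (_≟_ to _≟B_)

Vertex : ℕ → Set
Vertex n = Vec Bool n

hamming : ∀ {n} → Vertex n → Vertex n → ℕ
hamming []       []       = 0
hamming (a ∷ xs) (b ∷ ys) = (if ⌊ a ≟B b ⌋ then 0 else 1) + hamming xs ys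

cycDist : ∀ {L} → Fin L → Fin L → ℕ
cycDist {L} i j = ∣ toℕ i - toℕ j ∣ ⊓ (L ∸ ∣ toℕ i - toℕ j ∣)

record CircuitCode (n k L : ℕ) : Set where
  field
    vertex    : Fin L → Vertex n
    length≥3  : 3 ≤ L
    injective : Injective _≡_ _≡_ vertex
    edges     : ∀ i j → cycDist i j ≡ 1 → hamming (vertex i) (vertex j) ≡ 1
    induced   : ∀ i j → hamming (vertex i) (vertex j) ≡ 1 → cycDist i j ≡ 1
    spread    : ∀ i j → hamming (vertex i) (vertex j) < k →
                cycDist i j ≡ hamming (vertex i) (vertex j)

-- "K(n,k) ≥ 40 · 3^((m-8)/3)" : there is an (n,k) circuit code whose length L
-- satisfies L ≥ 40·3^((m-8)/3), equivalently (cubing, multiplying by 3^8)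
-- 64000 · 3^m ≤ 6561 · L^3.
KAtLeast40·3^[m-8]/3 : (n k m : ℕ) → Set
KAtLeast40·3^[m-8]/3 n k m = ∃ λ L → CircuitCode n k L × (64000 * 3 ^ m ≤ 6561 * L ^ 3)

{-# OPTIONS --safe #-}

-- A spread-4 code C of length 8q in dimension n yields one of length 40q in
-- dimension n + 6: run through C, making four moves in a 6-cube Q before each move
-- in C.  Positions whose C-parts are at least 4 apart along C are separated by C
-- itself, so the moves in Q only have to separate the positions inside any four
-- consecutive moves of C; moves with a pattern of period 8 (in C-moves) suffice.
-- Since 6 ≤ 1.53 · 4 and 5 ≥ 3^(4/3), four starting codes and induction in steps of 4
-- give the first bound, and the second follows by substituting ⌊0.6535 n⌋ for n.
module Submission where

open import Defs
open import Data.Bool using (Bool; true; false; not; if_then_else_)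
open import Data.Bool.Properties using () renaming (_≟_ to _≟B_)
open import Data.Fin using (Fin; toℕ)
open import Data.Fin.Properties using (toℕ-injective; toℕ<n)
open import Data.List using (List; []; _∷_; foldr; take; length; upTo) renaming (_++_ to _++ᴸ_)
open import Data.Nat
  using (ℕ; zero; suc; _+_; _*_; _∸_; _^_; _≤_; _<_; _⊓_; ∣_-_∣; z≤n; s≤s; NonZero; _≤?_; _<?_)
open import Data.Nat.DivMod using
  ( _/_; _%_; +-distrib-/-∣ʳ; /-monoˡ-≤; [m+kn]%n≡m%n; m%n<n; m*n/n≡m; m/n*n≤m
  ; m≡m%n+[m/n]*n; m∣n⇒o%n%m≡o%m)
open import Data.Nat.Divisibility using (divides; n∣m*n)
open import Data.Nat.Properties hiding (_≤?_; _<?_)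
open import Data.Nat.Tactic.RingSolver using (solve-∀)
open import Data.Product using (∃; _×_; _,_; proj₁; proj₂)
open import Data.Sum using (inj₁; inj₂)
open import Data.Vec using ([]; _∷_; _++_; replicate)
open import Relation.Binary.PropositionalEquality
  using (_≡_; refl; sym; trans; cong; cong₂; subst; subst₂; module ≡-Reasoning)
open import Relation.Nullary using (Dec; yes; no; contradiction)
open import Relation.Nullary.Decidable using (True; toWitness; from-yes; _×-dec_; ⌊_⌋)

-- Hamming distance on bit vectors.

hamming-refl : ∀ {n} (u : Vertex n) → hamming u u ≡ 0
hamming-refl []          = refl
hamming-refl (true ∷ u)  = hamming-refl u
hamming-refl (false ∷ u) = hamming-refl u

hamming-sym : ∀ {n} (u v : Vertex n) → hamming u v ≡ hamming v u
hamming-sym []          []          = refl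
hamming-sym (true ∷ u)  (true ∷ v)  = hamming-sym u v
hamming-sym (true ∷ u)  (false ∷ v) = cong suc (hamming-sym u v)
hamming-sym (false ∷ u) (true ∷ v)  = cong suc (hamming-sym u v)
hamming-sym (false ∷ u) (false ∷ v) = hamming-sym u v

differ : Bool → Bool → ℕ
differ a b = if ⌊ a ≟B b ⌋ then 0 else 1

differ-triangle : ∀ a b c → differ a c ≤ differ a b + differ b c
differ-triangle true  true  c     = ≤-refl
differ-triangle false false c     = ≤-refl
differ-triangle true  false true  = z≤n
differ-triangle true  false false = ≤-refl
differ-triangle false true  true  = ≤-refl
differ-triangle false true  false = z≤n

hamming-triangle : ∀ {n} (u v w : Vertex n) → hamming u w ≤ hamming u v + hamming v w
hamming-triangle []      []      []      = z≤n
hamming-triangle (a ∷ u) (b ∷ v) (c ∷ w) =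
  ≤-trans (+-mono-≤ (differ-triangle a b c) (hamming-triangle u v w))
          (≤-reflexive ([m+n]+[o+p]≡[m+o]+[n+p] (differ a b) (differ b c) (hamming u v) (hamming v w)))
  where
  [m+n]+[o+p]≡[m+o]+[n+p] : ∀ m n o p → (m + n) + (o + p) ≡ (m + o) + (n + p)
  [m+n]+[o+p]≡[m+o]+[n+p] = solve-∀

hamming-++ : ∀ {m n} (u v : Vertex m) (x y : Vertex n) →
             hamming (u ++ x) (v ++ y) ≡ hamming u v + hamming x y
hamming-++ []      []      x y = refl
hamming-++ (a ∷ u) (b ∷ v) x y =
  trans (cong (differ a b +_) (hamming-++ u v x y)) (sym (+-assoc (differ a b) _ _))

-- Periodic walks in the cube and circuits of spread 4.

Periodic : {A : Set} → ℕ → (ℕ → A) → Set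
Periodic L f = ∀ i → f (i + L) ≡ f i

-- Going from i to i + m and going on from i + m to i + L have the same endpoints.
hamming-complement : ∀ {n L} {f : ℕ → Vertex n} → Periodic L f → ∀ i m → m ≤ L →
                     hamming (f i) (f (i + m)) ≡ hamming (f (i + m)) (f ((i + m) + (L ∸ m)))
hamming-complement {L = L} {f} periodic i m m≤L = begin
  hamming (f i) (f (i + m))                       ≡⟨ hamming-sym (f i) _ ⟩
  hamming (f (i + m)) (f i)                       ≡⟨ cong (hamming (f (i + m))) (periodic i) ⟨
  hamming (f (i + m)) (f (i + L))                 ≡⟨ cong (λ k → hamming (f (i + m)) (f (i + k))) (m+[n∸m]≡n m≤L) ⟨
  hamming (f (i + m)) (f (i + (m + (L ∸ m))))     ≡⟨ cong (λ k → hamming (f (i + m)) (f k)) (+-assoc i m _) ⟨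
  hamming (f (i + m)) (f ((i + m) + (L ∸ m)))     ∎
  where open ≡-Reasoning

-- A circuit code of spread 4, parametrised by ℕ with period L.  Only lower bounds on
-- distances are required: the upper bounds follow from `step`.
record Circuit (n L : ℕ) : Set where
  field
    at       : ℕ → Vertex n
    periodic : Periodic L at
    step     : ∀ i → hamming (at i) (at (i + 1)) ≤ 1
    apart    : ∀ i m → m + 4 ≤ L → m ⊓ 4 ≤ hamming (at i) (at (i + m))
    8≤L      : 8 ≤ L

  walk-bound : ∀ i m → hamming (at i) (at (i + m)) ≤ m
  walk-bound i zero = ≤-reflexive
    (trans (cong (λ k → hamming (at i) (at k)) (+-identityʳ i)) (hamming-refl (at i)))
  walk-bound i (suc m) = begin
    hamming (at i) (at (i + suc m))
      ≡⟨ cong (λ k → hamming (at i) (at k)) (trans (cong (i +_) (+-comm 1 m)) (sym (+-assoc i m 1))) ⟩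
    hamming (at i) (at ((i + m) + 1))
      ≤⟨ hamming-triangle (at i) (at (i + m)) _ ⟩
    hamming (at i) (at (i + m)) + hamming (at (i + m)) (at ((i + m) + 1))
      ≤⟨ +-mono-≤ (walk-bound i m) (step (i + m)) ⟩
    m + 1
      ≡⟨ +-comm m 1 ⟩
    suc m ∎
    where open ≤-Reasoning

  upper : ∀ i m → m ≤ L → hamming (at i) (at (i + m)) ≤ m ⊓ (L ∸ m)
  upper i m m≤L = ⊓-glb (walk-bound i m)
    (≤-trans (≤-reflexive (hamming-complement periodic i m m≤L)) (walk-bound (i + m) (L ∸ m)))

  -- `apart` leaves out the `m` close to `L`. For those the complementary arc has length at most 4,
  -- and `8 ≤ L` brings that arc into the range of `apart`.
  lower : ∀ i m → m ≤ L → m ⊓ (L ∸ m) ⊓ 4 ≤ hamming (at i) (at (i + m))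
  lower i m m≤L with m + 4 ≤? L
  ... | yes m+4≤L = ≤-trans (⊓-monoˡ-≤ 4 (m⊓n≤m m (L ∸ m))) (apart i m m+4≤L)
  ... | no  m+4≰L = begin
    m ⊓ (L ∸ m) ⊓ 4                                     ≤⟨ ⊓-monoˡ-≤ 4 (m⊓n≤n m (L ∸ m)) ⟩
    (L ∸ m) ⊓ 4                                         ≤⟨ apart (i + m) (L ∸ m) short ⟩
    hamming (at (i + m)) (at ((i + m) + (L ∸ m)))       ≡⟨ hamming-complement periodic i m m≤L ⟨
    hamming (at i) (at (i + m))                         ∎
    where
    open ≤-Reasoning
    L∸m≤4 : L ∸ m ≤ 4
    L∸m≤4 = m≤n+o⇒m∸n≤o L m (<⇒≤ (≰⇒> m+4≰L))
    short : (L ∸ m) + 4 ≤ L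
    short = ≤-trans (+-monoˡ-≤ 4 L∸m≤4) 8≤L

  -- `upper` and `lower` coincide as long as the shorter arc is at most 4; a longer one would force
  -- distance at least 4.
  exact : ∀ i m → m ≤ L → hamming (at i) (at (i + m)) < 4 →
          m ⊓ (L ∸ m) ≡ hamming (at i) (at (i + m))
  exact i m m≤L h<4 with ≤-total (m ⊓ (L ∸ m)) 4
  ... | inj₁ c≤4 = ≤-antisym (subst (_≤ _) (m≤n⇒m⊓n≡m c≤4) (lower i m m≤L)) (upper i m m≤L)
  ... | inj₂ 4≤c = contradiction (subst (_≤ _) (m≥n⇒m⊓n≡n 4≤c) (lower i m m≤L)) (<⇒≱ h<4)

  -- The facts behind `edges` and `spread`, bundled so that the order of the two indices is split
  -- only once.
  MatchedBy : ℕ → ℕ → ℕ → Set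
  MatchedBy i j c = h ≤ c × (h < 4 → c ≡ h)
    where h = hamming (at i) (at j)

  matched-≤ : ∀ {i j} → i ≤ j → j < L → MatchedBy i j ((j ∸ i) ⊓ (L ∸ (j ∸ i)))
  matched-≤ {i} {j} i≤j j<L =
    subst (λ k → MatchedBy i k ((j ∸ i) ⊓ (L ∸ (j ∸ i)))) (m+[n∸m]≡n i≤j)
          (upper i (j ∸ i) j∸i≤L , exact i (j ∸ i) j∸i≤L)
    where
    j∸i≤L : j ∸ i ≤ L
    j∸i≤L = ≤-trans (m∸n≤m j i) (<⇒≤ j<L)

  matched-cycDist : ∀ (i j : Fin L) → MatchedBy (toℕ i) (toℕ j) (cycDist i j)
  matched-cycDist i j with ≤-total (toℕ i) (toℕ j)
  ... | inj₁ i≤j rewrite m≤n⇒∣m-n∣≡n∸m i≤j = matched-≤ i≤j (toℕ<n j)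
  ... | inj₂ j≤i rewrite m≤n⇒∣n-m∣≡n∸m j≤i | hamming-sym (at (toℕ i)) (at (toℕ j)) =
    matched-≤ j≤i (toℕ<n i)

-- From circuits to circuit codes.

cycDist≡0⇒≡ : ∀ {L} (i j : Fin L) → cycDist i j ≡ 0 → i ≡ j
cycDist≡0⇒≡ {L} i j c≡0 with ⊓-sel ∣ toℕ i - toℕ j ∣ (L ∸ ∣ toℕ i - toℕ j ∣)
... | inj₁ eq = toℕ-injective (∣m-n∣≡0⇒m≡n (trans (sym eq) c≡0))
-- Indices below `L` differ by less than `L`, so the arc the other way round is never empty.
... | inj₂ eq = contradiction (trans (sym eq) c≡0) (m>n⇒m∸n≢0 d<L)
  where
  d<L : ∣ toℕ i - toℕ j ∣ < L
  d<L = ≤-<-trans (∣m-n∣≤m⊔n (toℕ i) (toℕ j)) (⊔-lub (toℕ<n i) (toℕ<n j))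

-- All other conditions come from `spread`, because 0 and 1 are below 4. For `edges`, the upper
-- bound on the distance must first show that `spread` applies.
toCircuitCode : ∀ {n L} → Circuit n L → CircuitCode n 4 L
toCircuitCode {n} {L} C = record
  { vertex    = vertex
  ; length≥3  = ≤-trans (m≤m+n 3 5) 8≤L
  ; injective = λ {i} {j} eq → zero-distance i j
      (trans (cong (hamming (vertex i)) (sym eq)) (hamming-refl (vertex i)))
  ; edges     = edges
  ; induced   = λ i j h≡1 → trans (spread i j (subst (_< 4) (sym h≡1) (s≤s (s≤s z≤n)))) h≡1
  ; spread    = spread
  }
  where
  open Circuit C
  vertex : Fin L → Vertex n
  vertex i = at (toℕ i)
  spread : ∀ i j → hamming (vertex i) (vertex j) < 4 → cycDist i j ≡ hamming (vertex i) (vertex j)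
  spread i j = proj₂ (matched-cycDist i j)
  zero-distance : ∀ i j → hamming (vertex i) (vertex j) ≡ 0 → i ≡ j
  zero-distance i j h≡0 = cycDist≡0⇒≡ i j
    (trans (spread i j (subst (_< 4) (sym h≡0) (s≤s z≤n))) h≡0)
  edges : ∀ i j → cycDist i j ≡ 1 → hamming (vertex i) (vertex j) ≡ 1
  edges i j c≡1 = trans (sym (spread i j (≤-<-trans h≤1 (s≤s (s≤s z≤n))))) c≡1
    where
    h≤1 : hamming (vertex i) (vertex j) ≤ 1
    h≤1 = subst (hamming (vertex i) (vertex j) ≤_) c≡1 (proj₁ (matched-cycDist i j))

pad : ∀ {n n′ L} → n ≤ n′ → Circuit n L → Circuit n′ L
pad {n} {n′} {L} n≤n′ C = subst (λ k → Circuit k L) (m∸n+n≡m n≤n′) (record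
  { at       = λ i → zeros ++ at i
  ; periodic = λ i → cong (zeros ++_) (periodic i)
  ; step     = λ i → subst (_≤ 1) (sym (same i (i + 1))) (step i)
  ; apart    = λ i m le → subst (m ⊓ 4 ≤_) (sym (same i (i + m))) (apart i m le)
  ; 8≤L      = 8≤L
  })
  where
  open Circuit C
  zeros = replicate (n′ ∸ n) false
  same : ∀ i j → hamming (zeros ++ at i) (zeros ++ at j) ≡ hamming (at i) (at j)
  same i j = trans (hamming-++ zeros zeros (at i) (at j))
                   (cong (_+ hamming (at i) (at j)) (hamming-refl zeros))

-- Circuits given by transition sequences.

-- A coordinate beyond the dimension leaves the vertex unchanged.
flip : ∀ {n} → ℕ → Vertex n → Vertex n
flip _       []      = []
flip zero    (b ∷ v) = not b ∷ v
flip (suc k) (b ∷ v) = b ∷ flip k v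

-- Reducing i first makes this periodic for every τ; that the step from the end of τ back
-- to 0 is a legal move is part of the finite checks.
position : ∀ n (τ : List ℕ) .{{_ : NonZero (length τ)}} → ℕ → Vertex n
position n τ i = foldr flip (replicate n false) (take (i % length τ) τ)

position-+* : ∀ {n} (τ : List ℕ) .{{_ : NonZero (length τ)}} i k →
              position n τ (i + k * length τ) ≡ position n τ i
position-+* {n} τ i k =
  cong (λ r → foldr flip (replicate n false) (take r τ)) ([m+kn]%n≡m%n i k (length τ))

position-% : ∀ {n} (τ : List ℕ) .{{_ : NonZero (length τ)}} i m →
             position n τ (i % length τ + m) ≡ position n τ (i + m)
position-% {n} τ i m = trans (sym (position-+* τ _ (i / length τ)))
                             (cong (position n τ) (split (length τ)))
  where
  split : ∀ L .{{_ : NonZero L}} → (i % L + m) + (i / L) * L ≡ i + m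
  split L = trans (swap (i % L) m _) (cong (_+ m) (sym (m≡m%n+[m/n]*n i L)))
    where
    swap : ∀ a b c → (a + b) + c ≡ (a + c) + b
    swap = solve-∀

-- Lets a finite check over the starting points in one period speak for all of them.
hamming-position-% : ∀ {n} (τ : List ℕ) .{{_ : NonZero (length τ)}} i m →
  hamming (position n τ (i % length τ)) (position n τ (i % length τ + m)) ≡
  hamming (position n τ i) (position n τ (i + m))
hamming-position-% {n} τ i m = cong₂ hamming
  (trans (cong (position n τ) (sym (+-identityʳ _)))
         (trans (position-% τ i 0) (cong (position n τ) (+-identityʳ i))))
  (position-% τ i m)

-- The range `m < length τ ∸ 3` is the condition `m + 4 ≤ length τ` of `apart`, in the form over
-- which `allUpTo?` decides.
Closes : ∀ n (τ : List ℕ) .{{_ : NonZero (length τ)}} → ℕ → Set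
Closes n τ r =
  hamming (position n τ r) (position n τ (r + 1)) ≤ 1 ×
  (∀ {m} → m < length τ ∸ 3 → m ⊓ 4 ≤ hamming (position n τ r) (position n τ (r + m)))

closes? : ∀ n (τ : List ℕ) .{{_ : NonZero (length τ)}} r → Dec (Closes n τ r)
closes? n τ r = (_ ≤? 1) ×-dec allUpTo? (λ m → _ ≤? _) (length τ ∸ 3)

explicit : ∀ n (τ : List ℕ) .{{_ : NonZero (length τ)}} →
           {True (8 ≤? length τ)} → {True (allUpTo? (closes? n τ) (length τ))} →
           Circuit n (length τ)
explicit n τ {8≤} {closes} = record
  { at       = position n τ
  ; periodic = λ i → trans (cong (λ k → position n τ (i + k)) (sym (*-identityˡ (length τ))))
                           (position-+* τ i 1)
  ; step     = λ i → subst (_≤ 1) (hamming-position-% τ i 1)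
                       (proj₁ (toWitness closes (m%n<n i (length τ))))
  ; apart    = λ i m le → subst (m ⊓ 4 ≤_) (hamming-position-% τ i m)
                       (proj₂ (toWitness closes (m%n<n i (length τ)))
                         (m+n≤o⇒m≤o∸n (suc m) (≤-trans (≤-reflexive (sym (+-suc m 3))) le)))
  ; 8≤L      = toWitness 8≤
  }

-- Interleaving a circuit with moves in a 6-cube.

[i+m]/5 : ∀ i m → (i + m) / 5 ≡ i / 5 + (i % 5 + m) / 5
[i+m]/5 i m = begin
  (i + m) / 5                           ≡⟨ cong (_/ 5) regroup ⟩
  ((i % 5 + m) + i / 5 * 5) / 5         ≡⟨ +-distrib-/-∣ʳ (i % 5 + m) (n∣m*n (i / 5)) ⟩
  (i % 5 + m) / 5 + i / 5 * 5 / 5       ≡⟨ cong ((i % 5 + m) / 5 +_) (m*n/n≡m (i / 5) 5) ⟩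
  (i % 5 + m) / 5 + i / 5               ≡⟨ +-comm _ (i / 5) ⟩
  i / 5 + (i % 5 + m) / 5               ∎
  where
  open ≡-Reasoning
  swap : ∀ a b c → (a + c) + b ≡ (a + b) + c
  swap = solve-∀
  regroup : i + m ≡ (i % 5 + m) + i / 5 * 5
  regroup = trans (cong (_+ m) (m≡m%n+[m/n]*n i 5)) (swap (i % 5) m _)

-- Found by computer search.  The entries 6 (every fifth one) are the moves of the given
-- circuit; in the 6-cube they do nothing.
inserted : List ℕ
inserted =
  0 ∷ 1 ∷ 2 ∷ 3 ∷ 6 ∷ 4 ∷ 0 ∷ 1 ∷ 5 ∷ 6 ∷ 2 ∷ 0 ∷ 3 ∷ 1 ∷ 6 ∷ 4 ∷ 0 ∷ 2 ∷ 5 ∷ 6 ∷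
  3 ∷ 1 ∷ 2 ∷ 0 ∷ 6 ∷ 4 ∷ 3 ∷ 2 ∷ 5 ∷ 6 ∷ 1 ∷ 0 ∷ 3 ∷ 2 ∷ 6 ∷ 4 ∷ 1 ∷ 3 ∷ 5 ∷ 6 ∷ []

insertedDistance : ℕ → ℕ → ℕ
insertedDistance i m = hamming (position 6 inserted i) (position 6 inserted (i + m))

-- The phase s = i % 5 tells how many moves of the given circuit lie between i and i + m.
Interleaves : ℕ → ℕ → Set
Interleaves s i =
  (s + 1) / 5 + insertedDistance i 1 ≤ 1 ×
  (∀ {m} → m < 20 → m ⊓ 4 ≤ (s + m) / 5 ⊓ 4 + insertedDistance i m)

interleaves? : ∀ s i → Dec (Interleaves s i)
interleaves? s i = ((s + 1) / 5 + insertedDistance i 1 ≤? 1) ×-dec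
  allUpTo? (λ m → m ⊓ 4 ≤? (s + m) / 5 ⊓ 4 + insertedDistance i m) 20

interleaves-<40 : ∀ {i} → i < 40 → Interleaves (i % 5) i
interleaves-<40 = from-yes (allUpTo? (λ i → interleaves? (i % 5) i) 40)

-- As 5 divides 40, the phase of `i` depends only on `i % 40`, so the 40 checked cases suffice.
interleaves : ∀ i → Interleaves (i % 5) (i % 40)
interleaves i = subst (λ s → Interleaves s (i % 40)) (m∣n⇒o%n%m≡o%m 5 40 i (divides 8 refl))
                      (interleaves-<40 (m%n<n i 40))

-- Length `q * 8` makes the new length a multiple of 40, the period of `inserted`, so the walk in
-- the 6-cube closes up together with the given circuit.
interleave : ∀ {n} q → Circuit n (q * 8) → Circuit (n + 6) (q * 40)
interleave {n} q C = record
  { at       = at′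
  ; periodic = periodic′
  ; step     = step′
  ; apart    = apart′
  ; 8≤L      = 8≤40q
  }
  where
  open Circuit C
  at′ : ℕ → Vertex (n + 6)
  at′ i = at (i / 5) ++ position 6 inserted i

  40q≡8q*5 : q * 40 ≡ q * 8 * 5
  40q≡8q*5 = sym (*-assoc q 8 5)

  8≤40q : 8 ≤ q * 40
  8≤40q = ≤-trans 8≤L (*-monoʳ-≤ q (m≤m+n 8 32))

  [i+40q]/5 : ∀ i → (i + q * 40) / 5 ≡ i / 5 + q * 8
  [i+40q]/5 i = trans (cong (λ k → (i + k) / 5) 40q≡8q*5)
    (trans (+-distrib-/-∣ʳ i (n∣m*n (q * 8))) (cong (i / 5 +_) (m*n/n≡m (q * 8) 5)))

  periodic′ : Periodic (q * 40) at′
  periodic′ i = cong₂ _++_ (trans (cong at ([i+40q]/5 i)) (periodic (i / 5)))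
                           (position-+* inserted i q)

  circuitDistance : ℕ → ℕ → ℕ
  circuitDistance i m = hamming (at (i / 5)) (at (i / 5 + (i % 5 + m) / 5))

  hamming-at′ : ∀ i m → hamming (at′ i) (at′ (i + m)) ≡
                        circuitDistance i m + insertedDistance (i % 40) m
  hamming-at′ i m = trans
    (hamming-++ (at (i / 5)) (at ((i + m) / 5)) (position 6 inserted i) (position 6 inserted (i + m)))
    (cong₂ _+_ (cong (λ k → hamming (at (i / 5)) (at k)) ([i+m]/5 i m))
               (sym (hamming-position-% inserted i m)))

  step′ : ∀ i → hamming (at′ i) (at′ (i + 1)) ≤ 1
  step′ i = begin
    hamming (at′ i) (at′ (i + 1))
      ≡⟨ hamming-at′ i 1 ⟩
    circuitDistance i 1 + insertedDistance (i % 40) 1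
      ≤⟨ +-monoˡ-≤ (insertedDistance (i % 40) 1) (walk-bound (i / 5) ((i % 5 + 1) / 5)) ⟩
    (i % 5 + 1) / 5 + insertedDistance (i % 40) 1
      ≤⟨ proj₁ (interleaves i) ⟩
    1 ∎
    where open ≤-Reasoning

  -- The case in which i + m is reached from i by following C less than once around.
  apart-forward : ∀ i m → (i % 5 + m) / 5 + 4 ≤ q * 8 → m ⊓ 4 ≤ hamming (at′ i) (at′ (i + m))
  apart-forward i m le = begin
    m ⊓ 4
      ≤⟨ bound ⟩
    (i % 5 + m) / 5 ⊓ 4 + insertedDistance (i % 40) m
      ≤⟨ +-monoˡ-≤ (insertedDistance (i % 40) m) (apart (i / 5) ((i % 5 + m) / 5) le) ⟩
    circuitDistance i m + insertedDistance (i % 40) m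
      ≡⟨ hamming-at′ i m ⟨
    hamming (at′ i) (at′ (i + m)) ∎
    where
    open ≤-Reasoning
    bound : m ⊓ 4 ≤ (i % 5 + m) / 5 ⊓ 4 + insertedDistance (i % 40) m
    bound with m <? 20
    ... | yes m<20 = proj₂ (interleaves i) m<20
    -- Twenty moves include at least four of the given circuit, which alone account for distance 4.
    ... | no  m≮20 = begin
      m ⊓ 4                     ≤⟨ m⊓n≤n m 4 ⟩
      4                         ≡⟨ m≥n⇒m⊓n≡n 4≤δ ⟨
      (i % 5 + m) / 5 ⊓ 4       ≤⟨ m≤m+n ((i % 5 + m) / 5 ⊓ 4) (insertedDistance (i % 40) m) ⟩
      (i % 5 + m) / 5 ⊓ 4 + insertedDistance (i % 40) m ∎
      where
      4≤δ : 4 ≤ (i % 5 + m) / 5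
      4≤δ = /-monoˡ-≤ 5 (≤-trans (≮⇒≥ m≮20) (m≤n+m m (i % 5)))

  apart′ : ∀ i m → m + 4 ≤ q * 40 → m ⊓ 4 ≤ hamming (at′ i) (at′ (i + m))
  apart′ i m m+4≤40q with (i % 5 + m) / 5 + 4 ≤? q * 8
  ... | yes le = apart-forward i m le
  -- Here almost all of the given circuit is traversed. The complementary walk makes at most four of
  -- its moves but has at least 4 moves in all, so the forward case yields the full 4.
  ... | no  ≰  = begin
    m ⊓ 4                                         ≤⟨ m⊓n≤n m 4 ⟩
    4                                             ≡⟨ m≥n⇒m⊓n≡n (m+n≤o⇒m≤o∸n 4 (≤-trans (≤-reflexive (+-comm 4 m)) m+4≤40q)) ⟨
    m′ ⊓ 4                                        ≤⟨ apart-forward (i + m) m′ short ⟩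
    hamming (at′ (i + m)) (at′ ((i + m) + m′))    ≡⟨ hamming-complement periodic′ i m m≤40q ⟨
    hamming (at′ i) (at′ (i + m))                 ∎
    where
    open ≤-Reasoning
    m′ = q * 40 ∸ m
    δ  = (i % 5 + m) / 5
    δ′ = ((i + m) % 5 + m′) / 5
    m≤40q : m ≤ q * 40
    m≤40q = m+n≤o⇒m≤o m m+4≤40q
    δ+δ′≡8q : δ + δ′ ≡ q * 8
    -- After adding `i / 5`, both sides count the moves of the given circuit made up to position
    -- `i + q * 40`.
    δ+δ′≡8q = +-cancelˡ-≡ (i / 5) _ _ (begin-equality
      i / 5 + (δ + δ′)            ≡⟨ +-assoc (i / 5) δ δ′ ⟨
      (i / 5 + δ) + δ′            ≡⟨ cong (_+ δ′) ([i+m]/5 i m) ⟨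
      (i + m) / 5 + δ′            ≡⟨ [i+m]/5 (i + m) m′ ⟨
      ((i + m) + m′) / 5          ≡⟨ cong (_/ 5) (+-assoc i m m′) ⟩
      (i + (m + m′)) / 5          ≡⟨ cong (λ k → (i + k) / 5) (m+[n∸m]≡n m≤40q) ⟩
      (i + q * 40) / 5            ≡⟨ [i+40q]/5 i ⟩
      i / 5 + q * 8               ∎)
    δ′≤4 : δ′ ≤ 4
    δ′≤4 = +-cancelˡ-≤ δ δ′ 4 (≤-trans (≤-reflexive δ+δ′≡8q) (<⇒≤ (≰⇒> ≰)))
    short : δ′ + 4 ≤ q * 8
    short = ≤-trans (+-monoˡ-≤ 4 δ′≤4) 8≤L

-- Starting circuits.

-- Also found by search, among the transition sequences of the form w w.
half₉ half₁₀ half₁₂ half₁₃ : List ℕ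
half₉  = 0 ∷ 1 ∷ 2 ∷ 3 ∷ 4 ∷ 0 ∷ 5 ∷ 2 ∷ 6 ∷ 3 ∷ 7 ∷ 8 ∷ []
half₁₀ = 0 ∷ 1 ∷ 2 ∷ 3 ∷ 4 ∷ 5 ∷ 0 ∷ 1 ∷ 6 ∷ 3 ∷ 7 ∷ 8 ∷ 1 ∷ 5 ∷ 9 ∷ 7 ∷ []
half₁₂ = 0 ∷ 1 ∷ 2 ∷ 3 ∷ 4 ∷ 5 ∷ 1 ∷ 6 ∷ 0 ∷ 2 ∷ 7 ∷ 5 ∷ 1 ∷ 8 ∷ 9 ∷ 7 ∷ 2 ∷ 3 ∷ 8 ∷ 10 ∷ []
half₁₃ =
  0 ∷ 1 ∷ 2 ∷ 3 ∷ 4 ∷ 5 ∷ 6 ∷ 1 ∷ 7 ∷ 0 ∷ 8 ∷ 9 ∷ 3 ∷ 7 ∷ 2 ∷ 8 ∷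
  10 ∷ 11 ∷ 3 ∷ 1 ∷ 12 ∷ 9 ∷ 4 ∷ 5 ∷ 1 ∷ 2 ∷ 6 ∷ 0 ∷ 4 ∷ 8 ∷ 7 ∷ 10 ∷ []

-- All coordinates are flipped in order, twice: the second round undoes the first. This circuit and
-- the next serve the second bound for small `n`.
circuit₆,₁₂ : Circuit 6 12
circuit₆,₁₂ = explicit 6 (upTo 6 ++ᴸ upTo 6)

circuit₈,₁₆ : Circuit 8 16
circuit₈,₁₆ = explicit 8 (upTo 8 ++ᴸ upTo 8)

circuit₉,₂₄ : Circuit 9 24
circuit₉,₂₄ = explicit 9 (half₉ ++ᴸ half₉)

circuit₁₀,₃₂ : Circuit 10 32
circuit₁₀,₃₂ = explicit 10 (half₁₀ ++ᴸ half₁₀)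

circuit₁₂,₄₀ : Circuit 12 40
circuit₁₂,₄₀ = explicit 12 (half₁₂ ++ᴸ half₁₂)

circuit₁₃,₆₄ : Circuit 13 64
circuit₁₃,₆₄ = explicit 13 (half₁₃ ++ᴸ half₁₃)

-- Growth of length and dimension.

-- A record, since comparing unfolded multiplications by the large literals is infeasible.
record Long (m L : ℕ) : Set where
  constructor long
  field bound : 64000 * 3 ^ m ≤ 6561 * L ^ 3

-- The left side grows by 3^4 = 81 and the right side by 5^3 = 125. The constants are variables
-- here, which keeps the large literals out of the computation.
scale-long : ∀ a b m q → a * 3 ^ m ≤ b * (q * 8) ^ 3 → a * 3 ^ (m + 4) ≤ b * (q * 40) ^ 3
scale-long a b m q le = begin
  a * 3 ^ (m + 4)             ≡⟨ cong (a *_) (^-distribˡ-+-* 3 m 4) ⟩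
  a * (3 ^ m * 81)            ≡⟨ *-assoc a (3 ^ m) 81 ⟨
  a * 3 ^ m * 81              ≤⟨ *-mono-≤ le (m≤m+n 81 44) ⟩
  b * (q * 8) ^ 3 * 125       ≡⟨ *-assoc b ((q * 8) ^ 3) 125 ⟩
  b * ((q * 8) ^ 3 * 125)     ≡⟨ cong (b *_) (cube-*5 (q * 8)) ⟩
  b * (q * 8 * 5) ^ 3         ≡⟨ cong (λ L → b * L ^ 3) (*-assoc q 8 5) ⟩
  b * (q * 40) ^ 3            ∎
  where
  open ≤-Reasoning
  cube-*5 : ∀ x → x * (x * (x * 1)) * 125 ≡ (x * 5) * ((x * 5) * ((x * 5) * 1))
  cube-*5 = solve-∀

long-step : ∀ m q → Long m (q * 8) → Long (m + 4) (q * 40)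
long-step m q (long le) = long (scale-long 64000 6561 m q le)

-- Four steps of 1.53 make 6.12, enough for the 6 dimensions that `interleave` adds.
growth : ∀ n → (153 * n) / 100 + 6 ≤ (153 * (n + 4)) / 100
growth n = begin
  (153 * n) / 100 + 6           ≡⟨ +-distrib-/-∣ʳ (153 * n) (divides 6 refl) ⟨
  (153 * n + 600) / 100         ≤⟨ /-monoˡ-≤ 100 (+-monoʳ-≤ (153 * n) (m≤m+n 600 12)) ⟩
  (153 * n + 612) / 100         ≡⟨ cong (_/ 100) (*-distribˡ-+ 153 n 4) ⟨
  (153 * (n + 4)) / 100         ∎
  where open ≤-Reasoning

-- The base cases are n = 6, 7, 8, 9, where ⌊1.53 n⌋ is 9, 10, 12, 13; all lengths are multiples of
-- 8, as `interleave` demands. For n = 8 the length 40 meets the bound with equality.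
family : ∀ k → ∃ λ q → Circuit ((153 * (k + 6)) / 100) (q * 8) × Long (k + 6) (q * 8)
family 0 = 3 , circuit₉,₂₄ , long (≤ᵇ⇒≤ _ _ _)
family 1 = 4 , circuit₁₀,₃₂ , long (≤ᵇ⇒≤ _ _ _)
family 2 = 5 , circuit₁₂,₄₀ , long (≤ᵇ⇒≤ _ _ _)
family 3 = 8 , circuit₁₃,₆₄ , long (≤ᵇ⇒≤ _ _ _)
family (suc (suc (suc (suc k)))) with family k
... | q , C , C-long = q * 5 ,
  subst₂ (λ m L → Circuit ((153 * m) / 100) L × Long m L) (k+6+4 k) (sym (*-assoc q 5 8))
    (pad (growth (k + 6)) (interleave q C) , long-step (k + 6) q C-long)
  where
  k+6+4 : ∀ k → k + 6 + 4 ≡ 4 + k + 6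
  k+6+4 = solve-∀

-- The two bounds.

HasLongCircuit : ℕ → ℕ → Set
HasLongCircuit n m = ∃ λ L → Circuit n L × Long m L

toCode : ∀ {n m} → HasLongCircuit n m → KAtLeast40·3^[m-8]/3 n 4 m
toCode (L , C , long le) = L , toCircuitCode C , le

first-bound : ∀ n → 6 ≤ n → HasLongCircuit ((153 * n) / 100) n
first-bound n 6≤n with family (n ∸ 6)
... | q , C , C-long = q * 8 ,
  subst (λ m → Circuit ((153 * m) / 100) (q * 8) × Long m (q * 8)) (m∸n+n≡m 6≤n) (C , C-long)

-- 1.53 · 0.6535 = 0.999855 < 1
dimension-bound : ∀ n → (153 * ((6535 * n) / 10000)) / 100 ≤ n
dimension-bound n = begin
  (153 * m) / 100        ≤⟨ /-monoˡ-≤ 100 153m≤100n ⟩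
  (n * 100) / 100        ≡⟨ m*n/n≡m n 100 ⟩
  n                      ∎
  where
  open ≤-Reasoning
  m = (6535 * n) / 10000
  153m≤100n : 153 * m ≤ n * 100
  153m≤100n = *-cancelʳ-≤ (153 * m) (n * 100) 10000 (begin
    153 * m * 10000        ≡⟨ *-assoc 153 m 10000 ⟩
    153 * (m * 10000)      ≤⟨ *-monoʳ-≤ 153 (m/n*n≤m (6535 * n) 10000) ⟩
    153 * (6535 * n)       ≡⟨ *-assoc 153 6535 n ⟨
    999855 * n             ≤⟨ *-monoˡ-≤ n (m≤m+n 999855 145) ⟩
    1000000 * n            ≡⟨ *-comm 1000000 n ⟩
    n * 1000000            ≡⟨ *-assoc n 100 10000 ⟨
    n * 100 * 10000        ∎)

-- 10 is the least `n` with ⌊0.6535 n⌋ ≥ 6, where the first bound starts.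
second-bound-large : ∀ n → 10 ≤ n → HasLongCircuit n ((6535 * n) / 10000)
second-bound-large n 10≤n = extend (first-bound ((6535 * n) / 10000) 6≤m)
  where
  60000≤6535n : 60000 ≤ 6535 * n
  60000≤6535n = ≤-trans (≤ᵇ⇒≤ 60000 65350 _) (*-monoʳ-≤ 6535 10≤n)
  6≤m : 6 ≤ (6535 * n) / 10000
  6≤m = /-monoˡ-≤ {60000} {6535 * n} 10000 60000≤6535n
  extend : HasLongCircuit ((153 * ((6535 * n) / 10000)) / 100) ((6535 * n) / 10000) →
           HasLongCircuit n ((6535 * n) / 10000)
  extend (L , C , C-long) = L , pad (dimension-bound n) C , C-long

-- For n = 6, 7, 8, 9 the exponent ⌊0.6535 n⌋ is 3, 4, 5, 5, out of reach of the first bound, so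
-- these cases get explicit circuits.
second-bound : ∀ n → 6 ≤ n → HasLongCircuit n ((6535 * n) / 10000)
second-bound n 6≤n with m≤n⇒m<n∨m≡n 6≤n
... | inj₂ refl = 12 , circuit₆,₁₂ , long (≤ᵇ⇒≤ _ _ _)
... | inj₁ 7≤n with m≤n⇒m<n∨m≡n 7≤n
... | inj₂ refl = 12 , pad (n≤1+n 6) circuit₆,₁₂ , long (≤ᵇ⇒≤ _ _ _)
... | inj₁ 8≤n with m≤n⇒m<n∨m≡n 8≤n
... | inj₂ refl = 16 , circuit₈,₁₆ , long (≤ᵇ⇒≤ _ _ _)
... | inj₁ 9≤n with m≤n⇒m<n∨m≡n 9≤n
... | inj₂ refl = 16 , pad (n≤1+n 8) circuit₈,₁₆ , long (≤ᵇ⇒≤ _ _ _)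
... | inj₁ 10≤n = second-bound-large n 10≤n

theorem2 : ∀ (n : ℕ) → 6 ≤ n →
    KAtLeast40·3^[m-8]/3 ((153 * n) / 100) 4 n
      × KAtLeast40·3^[m-8]/3 n 4 ((6535 * n) / 10000)
theorem2 n 6≤n = toCode (first-bound n 6≤n) , toCode (second-bound n 6≤n)
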